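{- Every derivable sequent $\Gamma\vdash A$ of the sequent calculus has exactly one focused derivation.
   Context: Formulas are built from atoms ($p,q,\dots$) by a binary product: every formula is an atom or $A\bullet B$. A context is a finite (possibly empty) list of formulas; commas denote concatenation. The sequent calculus has exactly four rules (no weakening, contraction or exchange): ($\bullet L$) from $A,B,\Delta\vdash C$ infer $A\bullet B,\Delta\vdash C$ (the product must be the leftmost formula); ($\bullet R$) from $\Gamma\vdash A$ and $\Delta\vdash B$ infer $\Gamma,\Delta\vdash A\bullet B$; ($id$) $A\vdash A$; ($cut$) from $\Theta\vdash A$ and $\Gamma,A,\Delta\vdash B$ infer $\Gamma,\Theta,\Delta\vdash B$. A derivation is a finite rooted tree whose nodes are labelled by rule instances and whose edges are labelled by sequents; a sequent is derivable if it is the conclusion of a derivation with no undischarged premises. A context is irreducible if its leftmost formula is not a product (it is empty or begins with an atom). A focused derivation is a derivation (with no undischarged premises) using only: ($\bullet L$); ($\bullet R^{foc}$): from $\Gamma\vdash A$ and $\Delta\vdash B$ infer $\Gamma,\Delta\vdash A\bullet B$, where $\Gamma$ is irreducible; and ($id^{atm}$): $p\vdash p$ for atoms $p$. -}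

module Defs where

open import Level using (Level)
open import Data.List.Base using (List; []; _∷_; _++_)

private
  variable
    a : Level

infixl 7 _•_
infix  4 _⊢_

data Formula (Atom : Set a) : Set a where
  atom : Atom → Formula Atom
  _•_  : Formula Atom → Formula Atom → Formula Atom

Context : Set a → Set a
Context Atom = List (Formula Atom)

-- Γ ⊢ A is the type of closed derivations (no undischarged premises) of the
-- sequent, so the sequent is derivable when this type is inhabited.  The
-- constructors keep the contexts and formulas of the rule instance as implicit
-- arguments, hence propositional equality on Γ ⊢ A is identity of labelled
-- trees; in particular •R records how the context was split.
data _⊢_ {a : Level} {Atom : Set a} : Context Atom → Formula Atom → Set a where
  •L  : {A B C : Formula Atom} {Δ : Context Atom} →
        A ∷ B ∷ Δ ⊢ C → A • B ∷ Δ ⊢ C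
  •R  : {A B : Formula Atom} {Γ Δ : Context Atom} →
        Γ ⊢ A → Δ ⊢ B → Γ ++ Δ ⊢ A • B
  id  : {A : Formula Atom} →
        A ∷ [] ⊢ A
  cut : {A B : Formula Atom} {Γ Θ Δ : Context Atom} →
        Θ ⊢ A → Γ ++ A ∷ Δ ⊢ B → Γ ++ Θ ++ Δ ⊢ B

data Irreducible {a : Level} {Atom : Set a} : Context Atom → Set a where
  []-irr   : Irreducible []
  atom-irr : {p : Atom} {Γ : Context Atom} → Irreducible (atom p ∷ Γ)

-- The focused rules are restrictions of •R and id, so being focused is a
-- predicate on derivations.
data Focused {a : Level} {Atom : Set a} :
             {Γ : Context Atom} {A : Formula Atom} → Γ ⊢ A → Set a where
  •L-foc : {A B C : Formula Atom} {Δ : Context Atom} {d : A ∷ B ∷ Δ ⊢ C} →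
           Focused d → Focused (•L d)
  •R-foc : {A B : Formula Atom} {Γ Δ : Context Atom} {d : Γ ⊢ A} {e : Δ ⊢ B} →
           Irreducible Γ → Focused d → Focused e → Focused (•R d e)
  id-atm : {p : Atom} → Focused (id {A = atom p})

{-# OPTIONS --safe #-}
module Submission where

-- Existence: the rules •R, id and cut are admissible for focused derivations.
-- Cut is obtained from simultaneous substitution for all formulas of a context,
-- which, unlike single cut, needs no induction on the cut formula.
-- Uniqueness: the number of atom occurrences is the same on both sides of a
-- derivable sequent and positive for every formula, so the conclusion of •R
-- determines how its context is split; irreducibility of the left part of that
-- split decides between •L and •R.

open import Defs
open import Level using (Level)
open import Data.List.Base using ([]; _∷_; _++_; map)
open import Data.List.Properties using (++-assoc; ++-identityʳ; map-++; ∷-injective)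
open import Data.Nat.Base using (ℕ; _+_; _<_; z<s)
open import Data.Nat.ListAction using (sum)
open import Data.Nat.ListAction.Properties using (sum-++)
open import Data.Nat.Properties
  using (+-assoc; +-cancelˡ-≡; +-identityʳ; <⇒≢; <-≤-trans; m≤m+n)
open import Data.Product using (∃; ∃!; ∃₂; _×_; _,_)
open import Relation.Binary.PropositionalEquality
  using (_≡_; refl; sym; trans; cong; cong₂; subst; module ≡-Reasoning)
open import Relation.Nullary using (¬_; contradiction)

private
  variable
    a : Level
    Atom : Set a
    A B C : Formula Atom
    Γ Γ′ Δ Δ′ Θ : Context Atom

leaves : Formula Atom → ℕ
leaves (atom p) = 1
leaves (A • B)  = leaves A + leaves B

leavesᶜ : Context Atom → ℕ
leavesᶜ Γ = sum (map leaves Γ)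

0<leaves : (A : Formula Atom) → 0 < leaves A
0<leaves (atom p) = z<s
0<leaves (A • B)  = <-≤-trans (0<leaves A) (m≤m+n _ _)

0≢leavesᶜ-∷ : (A : Formula Atom) (Γ : Context Atom) → ¬ 0 ≡ leavesᶜ (A ∷ Γ)
0≢leavesᶜ-∷ A Γ = <⇒≢ (<-≤-trans (0<leaves A) (m≤m+n _ _))

leavesᶜ-++ : (Γ Δ : Context Atom) → leavesᶜ (Γ ++ Δ) ≡ leavesᶜ Γ + leavesᶜ Δ
leavesᶜ-++ Γ Δ = trans (cong sum (map-++ leaves Γ Δ)) (sum-++ (map leaves Γ) _)

⊢⇒leaves≡ : Γ ⊢ A → leavesᶜ Γ ≡ leaves A
⊢⇒leaves≡ (•L {A} {B} d) = trans (+-assoc (leaves A) (leaves B) _) (⊢⇒leaves≡ d)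
⊢⇒leaves≡ (•R {Γ = Γ} {Δ} d e) =
  trans (leavesᶜ-++ Γ Δ) (cong₂ _+_ (⊢⇒leaves≡ d) (⊢⇒leaves≡ e))
⊢⇒leaves≡ id = +-identityʳ _
⊢⇒leaves≡ (cut {A} {B} {Γ} {Θ} {Δ} d e) = begin
  leavesᶜ (Γ ++ Θ ++ Δ)               ≡⟨ leavesᶜ-++ Γ (Θ ++ Δ) ⟩
  leavesᶜ Γ + leavesᶜ (Θ ++ Δ)        ≡⟨ cong (leavesᶜ Γ +_) (leavesᶜ-++ Θ Δ) ⟩
  leavesᶜ Γ + (leavesᶜ Θ + leavesᶜ Δ) ≡⟨ cong (λ n → leavesᶜ Γ + (n + leavesᶜ Δ)) (⊢⇒leaves≡ d) ⟩
  leavesᶜ Γ + leavesᶜ (A ∷ Δ)         ≡⟨ leavesᶜ-++ Γ (A ∷ Δ) ⟨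
  leavesᶜ (Γ ++ A ∷ Δ)                ≡⟨ ⊢⇒leaves≡ e ⟩
  leaves B                            ∎
  where open ≡-Reasoning

[]⊬ : ¬ ([] ⊢ A)
[]⊬ {A = A} d = <⇒≢ (0<leaves A) (⊢⇒leaves≡ d)

-- Since every formula has a positive leaf count, two prefixes of one list with equal counts cannot
-- differ in length.
++-injective-leaves : (Γ Γ′ : Context Atom) → leavesᶜ Γ ≡ leavesᶜ Γ′ →
                      Γ ++ Δ ≡ Γ′ ++ Δ′ → Γ ≡ Γ′ × Δ ≡ Δ′
++-injective-leaves []      []       _ eq = refl , eq
++-injective-leaves []      (A ∷ Γ′) l _  = contradiction l (0≢leavesᶜ-∷ A Γ′)
++-injective-leaves (A ∷ Γ) []       l _  = contradiction (sym l) (0≢leavesᶜ-∷ A Γ)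
++-injective-leaves (A ∷ Γ) (_ ∷ Γ′) l eq with ∷-injective eq
... | refl , eq′ with ++-injective-leaves Γ Γ′ (+-cancelˡ-≡ (leaves A) _ _ l) eq′
...   | refl , refl = refl , refl

-- An empty `Γ` would expose the head of `Δ′`, possibly a product; the derivation of `C` excludes
-- this case.
•-∷-≢-irreducible-++ : Irreducible Γ → Γ ⊢ C → ¬ A • B ∷ Δ ≡ Γ ++ Δ′
•-∷-≢-irreducible-++ []-irr   d _ = []⊬ d
•-∷-≢-irreducible-++ atom-irr _ ()

-- The contexts are related by an equation because the indices `Γ ++ Δ` of two `•R` do not unify;
-- `eq` becomes `refl` only once the splits are known to agree.
focused-unique : {d : Γ ⊢ A} {d′ : Γ′ ⊢ A} → Focused d → Focused d′ →
                 (eq : Γ ≡ Γ′) → subst (_⊢ A) eq d ≡ d′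
focused-unique (•L-foc f) (•L-foc f′) refl = cong •L (focused-unique f f′ refl)
focused-unique (•L-foc f) (•R-foc {d = d′} i _ _) eq =
  contradiction eq (•-∷-≢-irreducible-++ i d′)
focused-unique (•R-foc {d = d} i _ _) (•L-foc f′) eq =
  contradiction (sym eq) (•-∷-≢-irreducible-++ i d)
focused-unique (•R-foc {Γ = Γ} {d = d} _ f g) (•R-foc {Γ = Γ′} {d = d′} _ f′ g′) eq
  -- Both left premises derive the same formula, so their contexts have equally many leaves.
  with ++-injective-leaves Γ Γ′ (trans (⊢⇒leaves≡ d) (sym (⊢⇒leaves≡ d′))) eq
focused-unique (•R-foc _ f g) (•R-foc _ f′ g′) refl | refl , refl =
  cong₂ •R (focused-unique f f′ refl) (focused-unique g g′ refl)
focused-unique id-atm id-atm refl = refl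

infix 4 _⊢ᶠ_

_⊢ᶠ_ : {Atom : Set a} → Context Atom → Formula Atom → Set a
Γ ⊢ᶠ A = ∃ λ (d : Γ ⊢ A) → Focused d

•Lᶠ : A ∷ B ∷ Δ ⊢ᶠ C → A • B ∷ Δ ⊢ᶠ C
•Lᶠ (d , f) = •L d , •L-foc f

irreducible-++ : Irreducible Γ → Γ ⊢ A → Irreducible (Γ ++ Δ)
irreducible-++ []-irr   d = contradiction d []⊬
irreducible-++ atom-irr _ = atom-irr

-- Each final `•L` of the left premise is moved below the new `•R`, until the left context is
-- irreducible.
•Rᶠ : {d : Γ ⊢ A} → Focused d → Δ ⊢ᶠ B → Γ ++ Δ ⊢ᶠ A • B
•Rᶠ (•L-foc f) g = •Lᶠ (•Rᶠ f g)
•Rᶠ f@(•R-foc {d = d} i _ _) (e , g) = •R _ e , •R-foc (irreducible-++ i d) f g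
•Rᶠ id-atm (e , g) = •R id e , •R-foc atom-irr id-atm g

idᶠ : (A : Formula Atom) → A ∷ [] ⊢ᶠ A
idᶠ (atom p) = id , id-atm
idᶠ (A • B) with idᶠ A
... | _ , f = •Lᶠ (•Rᶠ f (idᶠ B))

infixr 5 _∷_

data Sub {a : Level} {Atom : Set a} : Context Atom → Context Atom → Set a where
  []  : Sub [] []
  _∷_ : {Θ Γ Δ : Context Atom} {A : Formula Atom} →
        Θ ⊢ᶠ A → Sub Γ Δ → Sub (Θ ++ Γ) (A ∷ Δ)

lift : (Γ : Context Atom) → Sub Δ′ Δ → Sub (Γ ++ Δ′) (Γ ++ Δ)
lift []      σ = σ
lift (A ∷ Γ) σ = idᶠ A ∷ lift Γ σ

idSub : (Γ : Context Atom) → Sub Γ Γ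
idSub []      = []
idSub (A ∷ Γ) = idᶠ A ∷ idSub Γ

split : (Γ : Context Atom) → Sub Θ (Γ ++ Δ) →
        ∃₂ λ Γ′ Δ′ → Θ ≡ Γ′ ++ Δ′ × Sub Γ′ Γ × Sub Δ′ Δ
split []      σ = [] , _ , refl , [] , σ
split (A ∷ Γ) (_∷_ {Θ = Θ} d σ) with split Γ σ
... | Γ′ , Δ′ , refl , σ₁ , σ₂ =
  Θ ++ Γ′ , Δ′ , sym (++-assoc Θ Γ′ Δ′) , d ∷ σ₁ , σ₂

mutual
  -- Recursion is on the derivation substituted into, so the substituted ones may be arbitrary.
  substitute : {d : Γ ⊢ A} → Focused d → Sub Γ′ Γ → Γ′ ⊢ᶠ A
  substitute (•L-foc f) ((_ , g) ∷ σ) = substitute-•L f g σ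
  substitute (•R-foc {Γ = Γ} _ f g) σ with split Γ σ
  ... | _ , _ , refl , σ₁ , σ₂ with substitute f σ₁
  ...   | _ , f′ = •Rᶠ f′ (substitute g σ₂)
  substitute id-atm (d ∷ []) = subst (_⊢ᶠ _) (sym (++-identityʳ _)) d

  -- The inner recursion is on the derivation of `A • B`: its `•L` steps move to the conclusion, and
  -- its `•R` supplies separate derivations of `A` and `B`. Identity cannot occur, being atomic.
  substitute-•L : {d : A ∷ B ∷ Δ ⊢ C} {e : Θ ⊢ A • B} →
                  Focused d → Focused e → Sub Γ Δ → Θ ++ Γ ⊢ᶠ C
  substitute-•L f (•L-foc g) σ = •Lᶠ (substitute-•L f g σ)
  substitute-•L f (•R-foc {Γ = Θ₁} {Δ = Θ₂} _ g h) σ =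
    subst (_⊢ᶠ _) (sym (++-assoc Θ₁ Θ₂ _)) (substitute f ((_ , g) ∷ (_ , h) ∷ σ))

focus : Γ ⊢ A → Γ ⊢ᶠ A
focus (•L d) = •Lᶠ (focus d)
focus (•R d e) with focus d
... | _ , f = •Rᶠ f (focus e)
focus id = idᶠ _
focus (cut {Γ = Γ} {Δ = Δ} d e) with focus e
-- A cut substitutes for the cut formula and identities for all formulas around it.
... | _ , g = substitute g (lift Γ (focus d ∷ idSub Δ))

theorem1p17 : {a : Level} {Atom : Set a} (Γ : Context Atom) (A : Formula Atom) →
    Γ ⊢ A → ∃! _≡_ (λ (d : Γ ⊢ A) → Focused d)
theorem1p17 Γ A d with focus d
... | d′ , f = d′ , f , λ g → focused-unique f g refl
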